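{- Let $s_l=(a_j)$, $1\le j\le l$, be an ordered string of non-negative integers, and let $n$ be at least the order of the Kyle graph associated with $s_l$. Assume that $O_n(s_l)$ is connected. Then $d(v_1)=d(v_n)=\delta(O_n(s_l))=\sum_{j=1}^{l}a_j$, and $v_1$ and $v_n$ are the only vertices of $O_n(s_l)$ with degree $\delta(O_n(s_l))$.
   Context: An ordered string $s_l=(a_j)$, $1\le j\le l$ ($l\ge 1$), is an $l$-tuple of non-negative integers; $j$ is the index of the entry $a_j$. For a positive integer $n$, the ornated graph $O_n(s_l)$ is the (in general non-simple) directed graph on vertices $v_1,\dots,v_n$ whose arcs, counted with multiplicity, are the following: each odd-indexed entry $a_t$ contributes one arc $(v_i,v_j)$ for every pair $i<j$ with $i+a_t\ge j$; each even-indexed entry $a_s$ contributes one arc $(v_i,v_j)$ for every pair $i>j$ with $i-a_s\le j$. It is connected if its underlying undirected graph is connected. The degree of a vertex is $d(v)=d^+(v)+d^-(v)$ (out-degree plus in-degree, with multiplicity); $\Delta(O_n(s_l))$ and $\delta(O_n(s_l))$ are the maximum and minimum degree. The maximum possible degree associated with $s_l$ is $\max_{n\ge 1}\Delta(O_n(s_l))$. The Kyle graph associated with $s_l$ is the ornated graph $O_n(s_l)$ of smallest order $n$ that has a vertex of this maximum possible degree. -}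

module Defs where

open import Data.Fin.Base using (Fin; zero; suc; toℕ)
open import Data.Bool.Base using (if_then_else_)
open import Data.List.Base using (tabulate)
open import Data.List.Extrema.Nat using (max; min)
open import Data.Nat.Base using (ℕ; suc; _+_; _∸_; _≤_; _<_; parity)
open import Data.Nat.Properties using (_≤?_; _<?_; +-0-commutativeMonoid)
open import Data.Parity.Base using (Parity; 0ℙ; 1ℙ)
open import Data.Product.Base using (_×_; ∃)
open import Data.Vec.Functional using (Vector)
open import Function.Base using (_∘_)
open import Relation.Binary.Construct.Closure.Equivalence using (EqClosure)
open import Relation.Binary.PropositionalEquality.Core using (_≡_)
open import Relation.Nullary.Decidable using (Dec; does; _×-dec_)

open import Algebra.Properties.CommutativeMonoid.Sum +-0-commutativeMonoid public
  using (sum; sum-syntax)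

-- A finite directed multigraph, given by arc multiplicities:
-- G u v is the number of arcs from u to v.
MultiDigraph : ℕ → Set
MultiDigraph n = Fin n → Fin n → ℕ

outDegree : ∀ {n} → MultiDigraph n → Fin n → ℕ
outDegree {n} G v = ∑[ w < n ] G v w

inDegree : ∀ {n} → MultiDigraph n → Fin n → ℕ
inDegree {n} G v = ∑[ u < n ] G u v

degree : ∀ {n} → MultiDigraph n → Fin n → ℕ
degree G v = outDegree G v + inDegree G v

-- The first argument of max and min is only a default for the empty list;
-- being itself a degree, it does not affect the result.
Δ : ∀ {m} → MultiDigraph (suc m) → ℕ
Δ G = max (degree G zero) (tabulate (degree G))

δ : ∀ {m} → MultiDigraph (suc m) → ℕ
δ G = min (degree G zero) (tabulate (degree G))

-- The equivalence closure of the arc relation relates two vertices exactly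
-- when a walk in the underlying undirected graph joins them.
Connected : ∀ {n} → MultiDigraph n → Set
Connected G = ∀ u v → EqClosure (λ x y → 0 < G x y) u v

-- An ordered string of length l; t : Fin l stands for the index toℕ t + 1.
OrderedString : ℕ → Set
OrderedString l = Vector ℕ l

-- Vertices and string entries are numbered from 1.
index : ∀ {n} → Fin n → ℕ
index = suc ∘ toℕ

-- Arc p a i j: an entry a at an index of parity p contributes the arc
-- (vᵢ , vⱼ). Truncated subtraction is harmless in the even case, since 0 ≤ j.
Arc : Parity → ℕ → ℕ → ℕ → Set
Arc 1ℙ a i j = i < j × j ≤ i + a
Arc 0ℙ a i j = j < i × i ∸ a ≤ j

arc? : ∀ p a i j → Dec (Arc p a i j)
arc? 1ℙ a i j = i <? j ×-dec j ≤? i + a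
arc? 0ℙ a i j = j <? i ×-dec i ∸ a ≤? j

-- The ornated graph Oₙ(s).
O : ∀ {l} (n : ℕ) → OrderedString l → MultiDigraph n
O {l} n s u v =
  ∑[ t < l ] (if does (arc? (parity (index t)) (s t) (index u) (index v)) then 1 else 0)

-- D = max_{n ≥ 1} Δ(Oₙ(s)), the order n ≥ 1 being written suc m. A maximum over
-- infinitely many n cannot be computed outright, so it is given as a relation.
IsMaxPossibleDegree : ∀ {l} → OrderedString l → ℕ → Set
IsMaxPossibleDegree s D =
  (∃ λ m → Δ (O (suc m) s) ≡ D) × (∀ m → Δ (O (suc m) s) ≤ D)

AttainsMaxPossibleDegree : ∀ {l} → OrderedString l → ℕ → Set
AttainsMaxPossibleDegree s n =
  ∃ λ (v : Fin n) → IsMaxPossibleDegree s (degree (O n s) v)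

-- The Kyle graph associated with s is O k s for the k satisfying this.
IsKyleOrder : ∀ {l} → OrderedString l → ℕ → Set
IsKyleOrder s k =
  AttainsMaxPossibleDegree s k × (∀ n → AttainsMaxPossibleDegree s n → k ≤ n)

{-# OPTIONS --safe #-}

-- An entry a gives vᵢ exactly min(a, i − 1) + min(a, n − i) arcs, whatever the
-- parity of its index. Hence d(v) ≤ 2 Σ a, and this value is reached once n is
-- large, so a vertex of the Kyle graph has at least max a vertices on each
-- side. For n at least the Kyle order, every vertex therefore has at least
-- max a vertices on one of its sides, which gives d(v) ≥ Σ a; equality forces
-- the other side to be empty as soon as some entry is positive, and
-- connectedness provides such an entry when n ≥ 2.
module Submission where

open import Defs
open import Data.Bool.Base using (if_then_else_)
open import Data.Fin.Base using (Fin; zero; suc; fromℕ; toℕ; fromℕ<)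
open import Data.Fin.Properties
  using (toℕ-fromℕ; toℕ-fromℕ<; toℕ-injective; toℕ<n; toℕ≤pred[n])
open import Data.List.Base using (tabulate)
open import Data.List.Extrema.Nat using (xs≤max; min≤xs; v≤min⁺)
open import Data.List.Relation.Unary.All.Properties using (tabulate⁺; tabulate⁻)
open import Data.Nat.Base
open import Data.Nat.Properties
open import Data.Parity.Base using (0ℙ; 1ℙ)
open import Data.Product.Base using (_×_; _,_; ∃; proj₁; proj₂)
open import Data.Product.Function.NonDependent.Propositional using (_×-⇔_)
open import Data.Sum.Base as Sum using (_⊎_; inj₁; inj₂; [_,_]′)
open import Function.Base using (_∘_; _$_)
open import Function.Bundles using (_⇔_; mk⇔; Equivalence)
open import Function.Construct.Identity using (⇔-id)
open import Relation.Binary.Construct.Closure.ReflexiveTransitive using (_◅_)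
open import Relation.Binary.Construct.Closure.Symmetric using (fwd; bwd)
open import Relation.Binary.PropositionalEquality
open import Relation.Nullary.Decidable using (Dec; yes; does; dec-true; dec-false)
open import Relation.Nullary.Negation using (contradiction)
open import Algebra.Properties.CommutativeMonoid.Sum +-0-commutativeMonoid
  using (sum-cong-≗; ∑-distrib-+; ∑-comm)

private
  variable
    l m n : ℕ

sum-mono-≤ : {f g : Fin n → ℕ} → (∀ i → f i ≤ g i) → sum f ≤ sum g
sum-mono-≤ {zero}  f≤g = z≤n
sum-mono-≤ {suc n} f≤g = +-mono-≤ (f≤g zero) (sum-mono-≤ (f≤g ∘ suc))

term≤sum : (f : Fin n → ℕ) → ∀ i → f i ≤ sum f
term≤sum f zero    = m≤m+n _ _
term≤sum f (suc i) = ≤-trans (term≤sum (f ∘ suc) i) (m≤n+m _ _)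

sum-tight : {f g : Fin n → ℕ} → (∀ i → f i ≤ g i) → sum g ≤ sum f → ∀ i → g i ≤ f i
sum-tight {suc n} {f} {g} f≤g Σg≤Σf zero =
  +-cancelʳ-≤ (sum (g ∘ suc)) (g zero) (f zero)
    (≤-trans Σg≤Σf (+-monoʳ-≤ (f zero) (sum-mono-≤ (f≤g ∘ suc))))
sum-tight {suc n} {f} {g} f≤g Σg≤Σf (suc i) =
  sum-tight (f≤g ∘ suc)
    (+-cancelˡ-≤ (g zero) _ _ (≤-trans Σg≤Σf (+-monoˡ-≤ _ (f≤g zero)))) i

positive-term : (f : Fin n → ℕ) → 0 < sum f → ∃ λ i → 0 < f i
positive-term {suc n} f 0<Σ with f zero in eq
... | suc _ = zero , subst (0 <_) (sym eq) z<s
... | zero  = let i , 0<fi = positive-term (f ∘ suc) 0<Σ in suc i , 0<fi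

indicator : {A : Set} → Dec A → ℕ
indicator a? = if does a? then 1 else 0

count-interval : ∀ b c {P : Fin n → Set} (P? : ∀ w → Dec (P w)) →
                 (∀ w → P w ⇔ (b ≤ toℕ w × toℕ w < c)) →
                 ∑[ w < n ] indicator (P? w) ≡ c ⊓ n ∸ b
count-interval {zero} b c P? P⇔
  rewrite ⊓-zeroʳ c = sym (0∸n≡0 b)
count-interval {suc n} b zero P? P⇔
  rewrite dec-false (P? zero) (λ p → n≮0 (proj₂ (Equivalence.to (P⇔ zero) p))) =
  count-interval b zero (P? ∘ suc)
    λ w → mk⇔ (λ p → contradiction (proj₂ (Equivalence.to (P⇔ (suc w)) p)) n≮0)
              (λ { (_ , ()) })
count-interval {suc n} zero (suc c) P? P⇔
  rewrite dec-true (P? zero) (Equivalence.from (P⇔ zero) (z≤n , z<s)) =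
  cong suc $ count-interval zero c (P? ∘ suc)
    λ w → mk⇔ (λ p → z≤n , s<s⁻¹ (proj₂ (Equivalence.to (P⇔ (suc w)) p)))
              (λ { (_ , w<c) → Equivalence.from (P⇔ (suc w)) (z≤n , s<s w<c) })
count-interval {suc n} (suc b) (suc c) P? P⇔
  rewrite dec-false (P? zero) (λ p → n≮0 (proj₁ (Equivalence.to (P⇔ zero) p))) =
  count-interval b c (P? ∘ suc)
    λ w → mk⇔ (λ p → let b<w , w<c = Equivalence.to (P⇔ (suc w)) p in s≤s⁻¹ b<w , s<s⁻¹ w<c)
              (λ { (b≤w , w<c) → Equivalence.from (P⇔ (suc w)) (s≤s b≤w , s<s w<c) })

m∸[m∸n]≡n⊓m : ∀ m n → m ∸ (m ∸ n) ≡ n ⊓ m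
m∸[m∸n]≡n⊓m m n with ≤-total n m
... | inj₁ n≤m = trans (m∸[m∸n]≡n n≤m) (sym (m≤n⇒m⊓n≡m n≤m))
... | inj₂ m≤n = trans (cong (m ∸_) (m≤n⇒m∸n≡0 m≤n)) (sym (m≥n⇒m⊓n≡n m≤n))

m∸n≤o⇒m≤o+n : ∀ m n {o} → m ∸ n ≤ o → m ≤ o + n
m∸n≤o⇒m≤o+n m n m∸n≤o =
  ≤-trans (m≤n+m∸n m n) (≤-trans (+-monoʳ-≤ n m∸n≤o) (≤-reflexive (+-comm n _)))

m≤o+n⇒m∸n≤o : ∀ m n {o} → m ≤ o + n → m ∸ n ≤ o
m≤o+n⇒m∸n≤o m n m≤o+n = m≤n+o⇒m∸n≤o m n (≤-trans m≤o+n (≤-reflexive (+-comm _ n)))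

Arc-reverse : ∀ a i j → Arc 0ℙ a i j ⇔ Arc 1ℙ a j i
Arc-reverse a i j = ⇔-id _ ×-⇔ mk⇔ (m∸n≤o⇒m≤o+n i a) (m≤o+n⇒m∸n≤o i a)

count-later : ∀ a (v : Fin (suc m)) {P : Fin (suc m) → Set} (P? : ∀ w → Dec (P w)) →
              (∀ w → P w ⇔ Arc 1ℙ a (index v) (index w)) →
              ∑[ w < suc m ] indicator (P? w) ≡ a ⊓ (m ∸ toℕ v)
count-later {m} a v P? P⇔ = begin
  ∑[ w < suc m ] indicator (P? w)  ≡⟨ count-interval (suc i) (suc i + a) P? interval ⟩
  (i + a) ⊓ m ∸ i                  ≡⟨ ∸-distribʳ-⊓ i (i + a) m ⟩
  (i + a ∸ i) ⊓ (m ∸ i)            ≡⟨ cong (_⊓ (m ∸ i)) (m+n∸m≡n i a) ⟩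
  a ⊓ (m ∸ i)                      ∎
  where
  open ≡-Reasoning
  i = toℕ v
  interval : ∀ w → _ ⇔ (suc i ≤ toℕ w × toℕ w < suc i + a)
  interval w = mk⇔
    (λ p → let i<w , w≤i+a = Equivalence.to (P⇔ w) p in s<s⁻¹ i<w , w≤i+a)
    (λ { (i<w , w≤i+a) → Equivalence.from (P⇔ w) (s<s i<w , w≤i+a) })

count-earlier : ∀ a (v : Fin (suc m)) {P : Fin (suc m) → Set} (P? : ∀ w → Dec (P w)) →
                (∀ w → P w ⇔ Arc 1ℙ a (index w) (index v)) →
                ∑[ w < suc m ] indicator (P? w) ≡ a ⊓ toℕ v
count-earlier {m} a v P? P⇔ = begin
  ∑[ w < suc m ] indicator (P? w)  ≡⟨ count-interval (i ∸ a) i P? interval ⟩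
  i ⊓ suc m ∸ (i ∸ a)              ≡⟨ cong (_∸ (i ∸ a)) (m≤n⇒m⊓n≡m (<⇒≤ (toℕ<n v))) ⟩
  i ∸ (i ∸ a)                      ≡⟨ m∸[m∸n]≡n⊓m i a ⟩
  a ⊓ i                            ∎
  where
  open ≡-Reasoning
  i = toℕ v
  interval : ∀ w → _ ⇔ (i ∸ a ≤ toℕ w × toℕ w < i)
  interval w = mk⇔
    (λ p → let w<i , i≤w+a = Equivalence.to (P⇔ w) p
           in m≤o+n⇒m∸n≤o i a (s≤s⁻¹ i≤w+a) , s<s⁻¹ w<i)
    (λ { (i∸a≤w , w<i) → Equivalence.from (P⇔ w) (s<s w<i , s≤s (m∸n≤o⇒m≤o+n i a i∸a≤w)) })

entry-degree : ∀ p a (v : Fin (suc m)) →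
  ∑[ w < suc m ] indicator (arc? p a (index v) (index w)) +
  ∑[ w < suc m ] indicator (arc? p a (index w) (index v)) ≡
  a ⊓ toℕ v + a ⊓ (m ∸ toℕ v)
entry-degree 0ℙ a v = cong₂ _+_
  (count-earlier a v (λ w → arc? 0ℙ a (index v) (index w))
    (λ w → Arc-reverse a (index v) (index w)))
  (count-later a v (λ w → arc? 0ℙ a (index w) (index v))
    (λ w → Arc-reverse a (index w) (index v)))
entry-degree {m} 1ℙ a v = trans
  (cong₂ _+_
    (count-later a v (λ w → arc? 1ℙ a (index v) (index w)) (λ w → ⇔-id _))
    (count-earlier a v (λ w → arc? 1ℙ a (index w) (index v)) (λ w → ⇔-id _)))
  (+-comm (a ⊓ (m ∸ toℕ v)) (a ⊓ toℕ v))

degree-O : (s : OrderedString l) (v : Fin (suc m)) →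
           degree (O (suc m) s) v ≡ ∑[ t < l ] (s t ⊓ toℕ v + s t ⊓ (m ∸ toℕ v))
degree-O {l} {m} s v = begin
  ∑[ w < suc m ] ∑[ t < l ] out t w + ∑[ w < suc m ] ∑[ t < l ] into t w
    ≡⟨ cong₂ _+_ (∑-comm (λ w t → out t w)) (∑-comm (λ w t → into t w)) ⟩
  ∑[ t < l ] ∑[ w < suc m ] out t w + ∑[ t < l ] ∑[ w < suc m ] into t w
    ≡⟨ ∑-distrib-+ (λ t → sum (out t)) (λ t → sum (into t)) ⟨
  ∑[ t < l ] (∑[ w < suc m ] out t w + ∑[ w < suc m ] into t w)
    ≡⟨ sum-cong-≗ (λ t → entry-degree (parity (index t)) (s t) v) ⟩
  ∑[ t < l ] (s t ⊓ toℕ v + s t ⊓ (m ∸ toℕ v)) ∎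
  where
  open ≡-Reasoning
  out into : Fin l → Fin (suc m) → ℕ
  out  t w = indicator (arc? (parity (index t)) (s t) (index v) (index w))
  into t w = indicator (arc? (parity (index t)) (s t) (index w) (index v))

degree≤Δ : (G : MultiDigraph (suc m)) (v : Fin (suc m)) → degree G v ≤ Δ G
degree≤Δ G = tabulate⁻ {f = degree G} (xs≤max (degree G zero) (tabulate (degree G)))

δ≡degree : (G : MultiDigraph (suc m)) (v : Fin (suc m)) →
           (∀ w → degree G v ≤ degree G w) → δ G ≡ degree G v
δ≡degree G v v-min = ≤-antisym
  (tabulate⁻ {f = degree G} (min≤xs (degree G zero) (tabulate (degree G))) v)
  (v≤min⁺ (v-min zero) (tabulate⁺ {f = degree G} v-min))

max-possible-degree≥ : (s : OrderedString l) {D : ℕ} → IsMaxPossibleDegree s D →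
                       ∑[ t < l ] (s t + s t) ≤ D
max-possible-degree≥ {l} s {D} (_ , Δ≤D) = begin
  ∑[ t < l ] (s t + s t)                           ≡⟨ sum-cong-≗ (λ t → cong₂ _+_ (left t) (right t)) ⟨
  ∑[ t < l ] (s t ⊓ toℕ v + s t ⊓ (N + N ∸ toℕ v)) ≡⟨ degree-O s v ⟨
  degree (O (suc (N + N)) s) v                     ≤⟨ degree≤Δ (O (suc (N + N)) s) v ⟩
  Δ (O (suc (N + N)) s)                            ≤⟨ Δ≤D (N + N) ⟩
  D                                                ∎
  where
  open ≤-Reasoning
  -- Any common upper bound of the entries would do.
  N = sum s
  N< = s≤s (m≤m+n N N)
  v = fromℕ< N<
  toℕv : toℕ v ≡ N
  toℕv = toℕ-fromℕ< N<
  left : ∀ t → s t ⊓ toℕ v ≡ s t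
  left t = trans (cong (s t ⊓_) toℕv) (m≤n⇒m⊓n≡m (term≤sum s t))
  right : ∀ t → s t ⊓ (N + N ∸ toℕ v) ≡ s t
  right t = trans (cong (s t ⊓_) (trans (cong (N + N ∸_) toℕv) (m+n∸m≡n N N)))
                  (m≤n⇒m⊓n≡m (term≤sum s t))

max-degree-vertex : (s : OrderedString l) (v : Fin (suc m)) →
                    IsMaxPossibleDegree s (degree (O (suc m) s) v) →
                    ∀ t → s t ≤ toℕ v × s t ≤ m ∸ toℕ v
max-degree-vertex {m = m} s v D-max t =
  ≤-trans (+-cancelʳ-≤ (s t) _ _ (≤-trans tight (+-monoʳ-≤ _ (m⊓n≤m (s t) _)))) (m⊓n≤n (s t) _) ,
  ≤-trans (+-cancelˡ-≤ (s t) _ _ (≤-trans tight (+-monoˡ-≤ _ (m⊓n≤m (s t) _)))) (m⊓n≤n (s t) _)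
  where
  tight : s t + s t ≤ s t ⊓ toℕ v + s t ⊓ (m ∸ toℕ v)
  tight = sum-tight (λ u → +-mono-≤ (m⊓n≤m (s u) _) (m⊓n≤m (s u) _))
            (subst (_ ≤_) (degree-O s v) (max-possible-degree≥ s D-max)) t

Arc⇒positive : ∀ p {a i j} → Arc p a i j → 0 < a
Arc⇒positive 0ℙ {a} {i} {j} arc =
  let j<i , i≤j+a = Equivalence.to (Arc-reverse a i j) arc in
  +-cancelˡ-< j 0 a (subst (_< j + a) (sym (+-identityʳ j)) (<-≤-trans j<i i≤j+a))
Arc⇒positive 1ℙ {a} {i} (i<j , j≤i+a) =
  +-cancelˡ-< i 0 a (subst (_< i + a) (sym (+-identityʳ i)) (<-≤-trans i<j j≤i+a))

positive-entry : (s : OrderedString l) {u v : Fin n} → 0 < O n s u v → ∃ λ t → 0 < s t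
positive-entry s {u} {v} 0<O
  with t , 0<1t ← positive-term _ 0<O
  with yes arc ← arc? (parity (index t)) (s t) (index u) (index v)
  = t , Arc⇒positive (parity (index t)) arc

connected⇒positive-entry : (s : OrderedString l) → Connected (O (suc (suc m)) s) →
                           ∃ λ t → 0 < s t
connected⇒positive-entry s conn with conn zero (suc zero)
... | fwd arc ◅ _ = positive-entry s arc
... | bwd arc ◅ _ = positive-entry s arc

one-side-wide : ∀ {k} (p x : ℕ) → k ≤ m → p ≤ x ⊎ k ∸ p ≤ m ∸ x
one-side-wide p x k≤m with ≤-total p x
... | inj₁ p≤x = inj₁ p≤x
... | inj₂ x≤p = inj₂ (∸-mono k≤m x≤p)

m≤n⇒m≤m⊓n+o : ∀ {m n} o → m ≤ n → m ≤ m ⊓ n + o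
m≤n⇒m≤m⊓n+o o m≤n = ≤-trans (≤-reflexive (sym (m≤n⇒m⊓n≡m m≤n))) (m≤m+n _ o)

-- A positive entry a ≤ x contributes a + min(a, y) to the degree, so the
-- contribution can only be a if y vanishes.
other-side-empty : ∀ {a x y} → 0 < a → a ≤ x → a ⊓ x + a ⊓ y ≤ a → y ≡ 0
other-side-empty {y = zero}          0<a a≤x le = refl
other-side-empty {suc a} {y = suc y} 0<a a≤x le
  rewrite m≤n⇒m⊓n≡m a≤x = contradiction le (m+1+n≰m (suc a))

lemma2p12 : ∀ (l : ℕ) → 1 ≤ l → (s : OrderedString l) →
    ∀ (k : ℕ) → IsKyleOrder s k →
    ∀ (m : ℕ) → k ≤ suc m →
    let n  = suc m
        G  = O n s
        v₁ = zero {m}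
        vₙ = fromℕ m
    in Connected G →
       degree G v₁ ≡ degree G vₙ
       × degree G vₙ ≡ δ G
       × δ G ≡ ∑[ j < l ] s j
       × (∀ (v : Fin n) → degree G v ≡ δ G → v ≡ v₁ ⊎ v ≡ vₙ)
lemma2p12 l _ s (suc k) ((u , u-max) , _) m (s≤s k≤m) conn =
  trans d₁ (sym dₙ) , sym δ≡dₙ , δ≡Σ , λ v dv≡δ → ends v (≤-reflexive (trans dv≡δ δ≡Σ))
  where
  G = O (suc m) s

  wide : ∀ x → (∀ t → s t ≤ x) ⊎ (∀ t → s t ≤ m ∸ x)
  wide x = Sum.map
    (λ p≤x t → ≤-trans (proj₁ (max-degree-vertex s u u-max t)) p≤x)
    (λ q≤y t → ≤-trans (proj₂ (max-degree-vertex s u u-max t)) q≤y)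
    (one-side-wide (toℕ u) x k≤m)

  entries≤m : ∀ t → s t ≤ m
  entries≤m t = ≤-trans (proj₁ (max-degree-vertex s u u-max t)) (≤-trans (toℕ≤pred[n] u) k≤m)

  d₁ : degree G zero ≡ sum s
  d₁ = trans (degree-O s zero)
    (sum-cong-≗ λ t → cong₂ _+_ (⊓-zeroʳ (s t)) (m≤n⇒m⊓n≡m (entries≤m t)))

  dₙ : degree G (fromℕ m) ≡ sum s
  dₙ = trans (degree-O s (fromℕ m)) (sum-cong-≗ contribution)
    where
    contribution : ∀ t → s t ⊓ toℕ (fromℕ m) + s t ⊓ (m ∸ toℕ (fromℕ m)) ≡ s t
    contribution t = trans
      (cong (λ x → s t ⊓ x + s t ⊓ (m ∸ x)) (toℕ-fromℕ m))
      (trans (cong₂ _+_ (m≤n⇒m⊓n≡m (entries≤m t))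
                        (trans (cong (s t ⊓_) (n∸n≡0 m)) (⊓-zeroʳ (s t))))
             (+-identityʳ (s t)))

  contribution≥ : ∀ v t → s t ≤ s t ⊓ toℕ v + s t ⊓ (m ∸ toℕ v)
  contribution≥ v t =
    [ (λ s≤x → m≤n⇒m≤m⊓n+o _ (s≤x t))
    , (λ s≤y → ≤-trans (m≤n⇒m≤m⊓n+o _ (s≤y t)) (≤-reflexive (+-comm (s t ⊓ (m ∸ toℕ v)) _)))
    ]′ (wide (toℕ v))

  degree≥Σ : ∀ v → sum s ≤ degree G v
  degree≥Σ v = ≤-trans (sum-mono-≤ (contribution≥ v)) (≤-reflexive (sym (degree-O s v)))

  δ≡dₙ : δ G ≡ degree G (fromℕ m)
  δ≡dₙ = δ≡degree G (fromℕ m) (λ v → ≤-trans (≤-reflexive dₙ) (degree≥Σ v))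

  δ≡Σ : δ G ≡ sum s
  δ≡Σ = trans δ≡dₙ dₙ

  first : (v : Fin (suc m)) → toℕ v ≡ 0 → v ≡ zero
  first zero _ = refl

  last : (v : Fin (suc m)) → m ∸ toℕ v ≡ 0 → v ≡ fromℕ m
  last v m∸v≡0 = toℕ-injective
    (trans (≤-antisym (toℕ≤pred[n] v) (m∸n≡0⇒m≤n m∸v≡0)) (sym (toℕ-fromℕ m)))

  positive : ∀ {m} → Connected (O (suc m) s) → (v : Fin (suc m)) → v ≡ zero ⊎ ∃ λ t → 0 < s t
  positive {zero}  _    zero = inj₁ refl
  positive {suc m} conn _    = inj₂ (connected⇒positive-entry s conn)

  tight : ∀ v → degree G v ≤ sum s → ∀ t → s t ⊓ toℕ v + s t ⊓ (m ∸ toℕ v) ≤ s t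
  tight v dv≤Σ = sum-tight (contribution≥ v) (subst (_≤ sum s) (degree-O s v) dv≤Σ)

  ends : (v : Fin (suc m)) → degree G v ≤ sum s → v ≡ zero ⊎ v ≡ fromℕ m
  ends v dv≤Σ with positive conn v
  ... | inj₁ v≡v₁      = inj₁ v≡v₁
  ... | inj₂ (t , 0<a) = [ (λ s≤x → inj₂ (last v (other-side-empty 0<a (s≤x t) (tight v dv≤Σ t))))
                         , (λ s≤y → inj₁ (first v (other-side-empty 0<a (s≤y t)
                             (subst (_≤ s t) (+-comm (s t ⊓ toℕ v) _) (tight v dv≤Σ t)))))
                         ]′ (wide (toℕ v))
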